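{- For any procedure $p$ with body $S_p$ and procedure (Hoare logic) contract $C_p$, abstracted into component $m_p$ with contract $c_p$ (i.e. $m_p$ is the component abstracting the procedure set $\{p\}$ and $c_p$ is the denotational contract abstracting $C_p$), we have $$S_p\models^{\mathit{cr}}_{\mathit{par}}C_p\quad\text{if and only if}\quad m_p\models c_p.$$
   Context: Language. Let $\mathcal{P}$ be a finite set of procedure names. Statements are given by $S::=\mathsf{skip}\mid x:=a\mid S_1;S_2\mid\mathsf{if}\ b\ \mathsf{then}\ S_1\ \mathsf{else}\ S_2\mid\mathsf{while}\ b\ \mathsf{do}\ S\mid\mathsf{call}\ p$ with $p\in\mathcal{P}$, $a$ arithmetic and $b$ Boolean expressions over the (global, integer-valued) program variables. Declared procedures have declarations $\mathsf{proc}\ p\ \mathsf{is}\ S_p$. A procedure $p$ calls $p'$ if $\mathsf{call}\ p'$ occurs in $S_p$. $\mathbf{State}$ is the set of mappings from program variables to integers. Environments. For $P\subseteq\mathcal{P}$, $\mathbf{Env}_P$ is the set of functions $P\to 2^{\mathbf{State}\times\mathbf{State}}$. For $\rho\in\mathbf{Env}_P$, $\rho'\in\mathbf{Env}_{P'}$, $\rho\sqsubseteq\rho'$ iff $P\subseteq P'$ and $\rho(p)\subseteq\rho'(p)$ for all $p\in P$; $\sqcup$ denotes the lub ($\rho_1\sqcup\rho_2\in\mathbf{Env}_{P_1\cup P_2}$, $p\mapsto\rho_1(p)\cup\rho_2(p)$, reading $\rho_i(p)=\varnothing$ if $p\notin P_i$); $\rho^\top_P\in\mathbf{Env}_P$ maps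 every $p\in P$ to $\mathbf{State}\times\mathbf{State}$. An interface is a pair $(P^-,P^+)$ of disjoint sets of procedure names (required, provided). Denotations. For an interface $(P^-,P^+)$, $\rho^-\in\mathbf{Env}_{P^- }$ and $\rho^+\in\mathbf{Env}_{P^+}$, the denotation $[\![S]\!]^{\rho^+}_{\rho^- }\subseteq\mathbf{State}\times\mathbf{State}$ is the standard relational one, by induction on $S$: $\mathsf{skip}$ denotes the identity relation; $x:=a$ denotes $\{(s,s[x\mapsto a(s)])\}$, where $a(s)$ is the value of $a$ in $s$; $S_1;S_2$ denotes the relational composition (first $S_1$, then $S_2$); the conditional denotes the union of the denotation of $S_1$ restricted to initial states satisfying $b$ and that of $S_2$ restricted to initial states not satisfying $b$; $\mathsf{while}\ b\ \mathsf{do}\ S$ denotes the least relation $R$ such that $R=\{(s,s)\mid s\not\models b\}\cup\{(s,s'')\mid s\models b,\ \exists s'.\,(s,s')\in[\![S]\!]^{\rho^+}_{\rho^- },(s',s'')\in R\}$; and $[\![\mathsf{call}\ p]\!]^{\rho^+}_{\rho^- }$ is $\rho^-(p)$ if $p\in P^-$ and $\rho^+(p)$ if $p\in P^+$. Given $\rho^-\in\mathbf{Env}_{P^- }$, let $\xi:\mathbf{Env}_{P^+}\to\mathbf{Env}_{P^+}$ be $\xi(\rho^+)(p)=[\![S_p]\!]^{\rho^+}_{\rho^- }$ for $p\in P^+$; it is monotonic, and $\rho^+_0$ denotes its least fixed point. The standard denotation is $[\![S]\!]_{\rho^- }:=[\![S]\!]^{\rho^+_0}_{\rho^- }$. Hoare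 logic contracts. A Hoare logic contract is a pair $C=(P,Q)$ of assertions (pre- and post-condition) over program variables and logical variables; logical variables are given values by interpretations $\mathcal{I}$, and $s\models_{\mathcal{I}}P$ means $P$ is true in state $s$ under $\mathcal{I}$. Its denotation is $[\![C]\!]:=\{(s,s')\mid\forall\mathcal{I}.\ (s\models_{\mathcal{I}}P\Rightarrow s'\models_{\mathcal{I}}Q)\}$. Every procedure $p\in\mathcal{P}$ is equipped with a contract $C_p$. The contract environment $\rho_c\in\mathbf{Env}_{\mathcal{P}}$ is $\rho_c(p):=[\![C_p]\!]$ for all $p\in\mathcal{P}$. The contract-relative denotation of a statement is $[\![S]\!]^{cr}:=[\![S]\!]_{\rho_c}$, i.e. every call $\mathsf{call}\ p$, $p\in\mathcal{P}$, is interpreted as $\rho_c(p)$ (no fixed point is involved). $S\models^{\mathit{cr}}_{\mathit{par}}C$ iff $[\![S]\!]^{cr}\subseteq[\![C]\!]$. Components and denotational contracts. A component $m$ with interface $(P^-_m,P^+_m)$ is a mapping $m:\mathbf{Env}_{P^-_m}\to\mathbf{Env}_{P^+_m}$. A denotational contract $c$ with interface $(P^-_c,P^+_c)$ is a pair $(\rho^-_c,\rho^+_c)\in\mathbf{Env}_{P^-_c}\times\mathbf{Env}_{P^+_c}$. $m\models c$ ($m$ implements $c$) iff $P^-_c\subseteq P^-_m$, $P^+_m\subseteq P^+_c$ and $m(\rho^-_c\sqcup\rho^\top_{P^-_m\setminus P^-_c})\sqsubseteq\rho^+_c$. Abstractions. A set $P^+$ of declared procedures, whose set of called procedures is $P'$,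 is abstracted into the component $m$ with $P^+_m:=P^+$, $P^-_m:=P'\setminus P^+_m$ and $m(\rho^-_m)(p):=[\![S_p]\!]_{\rho^-_m}$ for all $\rho^-_m\in\mathbf{Env}_{P^-_m}$, $p\in P^+_m$, the standard denotation being taken in the context of the interface $(P^-_m,P^+_m)$. For a procedure $p$ with Hoare logic contract $C_p$, calling other procedures $P^-$, the denotational contract $c_p=(\rho^-_{c_p},\rho^+_{c_p})$ has $P^+_{c_p}:=\{p\}$, $P^-_{c_p}:=P^-$, $\rho^+_{c_p}(p):=\rho_c(p)$, and $\rho^-_{c_p}(p'):=\rho_c(p')$ for all $p'\in P^-$.
   Formalization: The "if" direction (m_p ⊨ c_p implies S_p ⊨cr C_p) is stated only for procedures p whose body does not call p itself; for self-recursive p it is false, e.g. S_p = call p; x := 1 with C_p = (true, x = 0). The "only if" direction covers every p. -}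

module Defs where

open import Data.Bool.Base using (Bool; true; false; if_then_else_)
open import Data.Empty using (⊥-elim-irr)
open import Data.Fin.Base using (Fin; zero)
open import Data.Fin.Subset
  using (Subset; ⊥; ⊤; ⁅_⁆; _∈_; _⊆_; _∪_; _∩_; _─_; ⋃; Empty)
open import Data.Fin.Subset.Properties
  using (_∈?_; ∉⊥; p⊆p∪q; q⊆p∪q; x∈p∧x∉q⇒x∈p─q; p∩q⊆q; ∈⊤)
open import Data.Integer.Base using (ℤ)
open import Data.List.Base using (map; allFin)
open import Data.Nat.Base as ℕ using (ℕ; zero; suc; _≤_; z≤n; s≤s)
open import Data.Nat.Properties using (m≤m⊔n; m≤n⊔m)
open import Data.Product.Base using (Σ; ∃; _×_; _,_; proj₁; proj₂)
open import Data.Sum.Base using (_⊎_; inj₁; inj₂)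
open import Data.Vec.Base using (_∷_; there)
open import Level using (0ℓ) renaming (_⊔_ to _⊔ˡ_)
open import Relation.Binary.Construct.Always using (Always)
open import Relation.Binary.Construct.Composition using (_;_)
open import Relation.Binary.Core using (Rel; _⇒_)
open import Relation.Binary.Definitions using (DecidableEquality)
open import Relation.Binary.PropositionalEquality using (_≡_; refl)
open import Relation.Nullary.Decidable using (yes; no; does)

-- Requiring `least` of all pre-fixed points makes x in particular the least
-- among the fixed points.
record IsLeastFixedPoint {a r} {A : Set a} (_≲_ : Rel A r)
                         (f : A → A) (x : A) : Set (a ⊔ˡ r) where
  field
    prefixed  : f x ≲ x
    postfixed : x ≲ f x
    least     : ∀ {y} → f y ≲ y → x ≲ y

record LeastFixedPoint {a r} {A : Set a} (_≲_ : Rel A r)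
                       (f : A → A) : Set (a ⊔ˡ r) where
  field
    point             : A
    isLeastFixedPoint : IsLeastFixedPoint _≲_ f point

-- The expression and assertion languages are left open: any syntax with an
-- evaluation function, respectively a satisfaction relation, will do.
record Language : Set₁ where
  field
    Var : Set
    _≟_ : DecidableEquality Var

  State : Set
  State = Var → ℤ

  field
    AExp : Set
    ⟦_⟧ᵃ : AExp → State → ℤ
    BExp : Set
    ⟦_⟧ᵇ : BExp → State → Bool
    LVar : Set
    LVal : Set

  Interpretation : Set
  Interpretation = LVar → LVal

  field
    Assertion : Set
    _⊨[_]_    : State → Interpretation → Assertion → Set

  _[_↦_] : State → Var → ℤ → State
  (s [ x ↦ v ]) y = if does (x ≟ y) then v else s y

-- The procedure names are the elements of Fin n.
module Theory (L : Language) (n : ℕ) where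

  open Language L

  data Stmt : Set where
    skip          : Stmt
    _≔_           : Var → AExp → Stmt
    _⨾_           : Stmt → Stmt → Stmt
    if_then_else′ : BExp → Stmt → Stmt → Stmt
    while_loop    : BExp → Stmt → Stmt
    call          : Fin n → Stmt

  calls : Stmt → Subset n
  calls skip                    = ⊥
  calls (x ≔ a)                 = ⊥
  calls (S₁ ⨾ S₂)               = calls S₁ ∪ calls S₂
  calls (if_then_else′ b S₁ S₂) = calls S₁ ∪ calls S₂
  calls (while_loop b S)        = calls S
  calls (call p)                = ⁅ p ⁆

  -- A set P of declared procedures, together with their bodies.
  Decls : Subset n → Set
  Decls P = ∀ p → .(p ∈ P) → Stmt

  calledBy : ∀ {P} → Decls P → Fin n → Subset n
  calledBy {P} D p with p ∈? P
  ... | yes p∈P = calls (D p p∈P)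
  ... | no  _   = ⊥

  called : ∀ {P} → Decls P → Subset n
  called D = ⋃ (map (calledBy D) (allFin n))

  Env : Subset n → Set₁
  Env P = ∀ p → .(p ∈ P) → Rel State 0ℓ

  infix 4 _⊑_
  _⊑_ : ∀ {P P′} → Env P → Env P′ → Set
  _⊑_ {P} {P′} ρ ρ′ =
    Σ (P ⊆ P′) λ P⊆P′ → ∀ p (p∈P : p ∈ P) → ρ p p∈P ⇒ ρ′ p (P⊆P′ p∈P)

  infixr 6 _⊔_
  _⊔_ : ∀ {P₁ P₂} → Env P₁ → Env P₂ → Env (P₁ ∪ P₂)
  _⊔_ {P₁} {P₂} ρ₁ ρ₂ p _ s s′ =
    (Σ (p ∈ P₁) λ p∈P₁ → ρ₁ p p∈P₁ s s′) ⊎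
    (Σ (p ∈ P₂) λ p∈P₂ → ρ₂ p p∈P₂ s s′)

  ρ⊤ : ∀ P → Env P
  ρ⊤ P _ _ = Always

  restrict : ∀ {P P′} → P ⊆ P′ → Env P′ → Env P
  restrict P⊆P′ ρ p p∈P = ρ p (P⊆P′ p∈P)

  record Interface : Set where
    field
      P⁻ P⁺    : Subset n
      disjoint : Empty (P⁻ ∩ P⁺)

  open Interface


  Unroll : BExp → Rel State 0ℓ → Rel State 0ℓ → Rel State 0ℓ
  Unroll b R X s s″ =
    (⟦ b ⟧ᵇ s ≡ false × s ≡ s″) ⊎ (⟦ b ⟧ᵇ s ≡ true × (R ; X) s s″)

  data While (b : BExp) (R : Rel State 0ℓ) : Rel State 0ℓ where
    stop : ∀ {s} → ⟦ b ⟧ᵇ s ≡ false → While b R s s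
    step : ∀ {s s′ s″} → ⟦ b ⟧ᵇ s ≡ true → R s s′ → While b R s′ s″ →
           While b R s s″

  While-isLeastFixedPoint : ∀ b R → IsLeastFixedPoint _⇒_ (Unroll b R) (While b R)
  While-isLeastFixedPoint b R = record
    { prefixed  = pre
    ; postfixed = post
    ; least     = λ {X} → lst {X}
    }
    where
    pre : Unroll b R (While b R) ⇒ While b R
    pre (inj₁ (¬b , refl))       = stop ¬b
    pre (inj₂ (b✓ , _ , r , w)) = step b✓ r w

    post : While b R ⇒ Unroll b R (While b R)
    post (stop ¬b)     = inj₁ (¬b , refl)
    post (step b✓ r w) = inj₂ (b✓ , _ , r , w)

    lst : ∀ {X} → Unroll b R X ⇒ X → While b R ⇒ X
    lst f (stop ¬b)     = f (inj₁ (¬b , refl))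
    lst f (step b✓ r w) = f (inj₂ (b✓ , _ , r , lst f w))

  -- In the clause for call at most one summand is inhabited, since P⁻ and P⁺
  -- are disjoint; a call to a procedure outside the interface denotes ∅.
  infix 8 _⟦_⟧
  _⟦_⟧ : (I : Interface) → Stmt → Env (P⁻ I) → Env (P⁺ I) → Rel State 0ℓ
  (I ⟦ skip ⟧) ρ⁻ ρ⁺ s s′ = s′ ≡ s
  (I ⟦ x ≔ a ⟧) ρ⁻ ρ⁺ s s′ = s′ ≡ s [ x ↦ ⟦ a ⟧ᵃ s ]
  (I ⟦ S₁ ⨾ S₂ ⟧) ρ⁻ ρ⁺ = (I ⟦ S₁ ⟧) ρ⁻ ρ⁺ ; (I ⟦ S₂ ⟧) ρ⁻ ρ⁺
  (I ⟦ if_then_else′ b S₁ S₂ ⟧) ρ⁻ ρ⁺ s s′ =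
    (⟦ b ⟧ᵇ s ≡ true  × (I ⟦ S₁ ⟧) ρ⁻ ρ⁺ s s′) ⊎
    (⟦ b ⟧ᵇ s ≡ false × (I ⟦ S₂ ⟧) ρ⁻ ρ⁺ s s′)
  (I ⟦ while_loop b S ⟧) ρ⁻ ρ⁺ = While b ((I ⟦ S ⟧) ρ⁻ ρ⁺)
  (I ⟦ call p ⟧) ρ⁻ ρ⁺ s s′ =
    (Σ (p ∈ P⁻ I) λ p∈P⁻ → ρ⁻ p p∈P⁻ s s′) ⊎
    (Σ (p ∈ P⁺ I) λ p∈P⁺ → ρ⁺ p p∈P⁺ s s′)

  ξ : (I : Interface) → Decls (P⁺ I) → Env (P⁻ I) → Env (P⁺ I) → Env (P⁺ I)
  ξ I D ρ⁻ ρ⁺ p p∈P⁺ = (I ⟦ D p p∈P⁺ ⟧) ρ⁻ ρ⁺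

  While-mono : ∀ {b R R′} → R ⇒ R′ → While b R ⇒ While b R′
  While-mono f (stop ¬b)     = stop ¬b
  While-mono f (step b✓ r w) = step b✓ (f r) (While-mono f w)

  ⟦⟧-mono : ∀ I S {ρ⁻ : Env (P⁻ I)} {ρ σ : Env (P⁺ I)} →
            ρ ⊑ σ → (I ⟦ S ⟧) ρ⁻ ρ ⇒ (I ⟦ S ⟧) ρ⁻ σ
  ⟦⟧-mono I skip      le d = d
  ⟦⟧-mono I (x ≔ a)   le d = d
  ⟦⟧-mono I (S₁ ⨾ S₂) le (t , d , e) = t , ⟦⟧-mono I S₁ le d , ⟦⟧-mono I S₂ le e
  ⟦⟧-mono I (if_then_else′ b S₁ S₂) le (inj₁ (e , d)) = inj₁ (e , ⟦⟧-mono I S₁ le d)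
  ⟦⟧-mono I (if_then_else′ b S₁ S₂) le (inj₂ (e , d)) = inj₂ (e , ⟦⟧-mono I S₂ le d)
  ⟦⟧-mono I (while_loop b S) le d = While-mono (⟦⟧-mono I S le) d
  ⟦⟧-mono I (call p)  le (inj₁ d) = inj₁ d
  ⟦⟧-mono I (call p)  le (inj₂ (i , d)) = inj₂ (i , proj₂ le p i d)

  -- The least fixed point of ξ is obtained as the union of the Kleene chain
  -- ∅, ξ ∅, ξ (ξ ∅), …
  module Kleene (I : Interface) (D : Decls (P⁺ I)) (ρ⁻ : Env (P⁻ I)) where

    data ∅ : Rel State 0ℓ where

    chain : ℕ → Env (P⁺ I)
    chain zero    _ _ = ∅
    chain (suc k)     = ξ I D ρ⁻ (chain k)

    union : Env (P⁺ I)
    union p p∈P⁺ s s′ = ∃ λ k → chain k p p∈P⁺ s s′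

    chain-mono : ∀ {j k} → j ≤ k → chain j ⊑ chain k
    chain-mono z≤n       = (λ i → i) , λ _ _ ()
    chain-mono (s≤s j≤k) = (λ i → i) , λ p i → ⟦⟧-mono I (D p i) (chain-mono j≤k)

    lift : ∀ S {j k} → j ≤ k → (I ⟦ S ⟧) ρ⁻ (chain j) ⇒ (I ⟦ S ⟧) ρ⁻ (chain k)
    lift S j≤k = ⟦⟧-mono I S (chain-mono j≤k)

    continuous : ∀ S {s s′} → (I ⟦ S ⟧) ρ⁻ union s s′ →
                 ∃ λ k → (I ⟦ S ⟧) ρ⁻ (chain k) s s′
    continuous-while : ∀ b S {s s′} → While b ((I ⟦ S ⟧) ρ⁻ union) s s′ →
                       ∃ λ k → While b ((I ⟦ S ⟧) ρ⁻ (chain k)) s s′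

    continuous skip    d = 0 , d
    continuous (x ≔ a) d = 0 , d
    continuous (S₁ ⨾ S₂) (t , d , e) with continuous S₁ d | continuous S₂ e
    ... | j , d′ | k , e′ =
      j ℕ.⊔ k , t , lift S₁ (m≤m⊔n j k) d′ , lift S₂ (m≤n⊔m j k) e′
    continuous (if_then_else′ b S₁ S₂) (inj₁ (e , d)) with continuous S₁ d
    ... | k , d′ = k , inj₁ (e , d′)
    continuous (if_then_else′ b S₁ S₂) (inj₂ (e , d)) with continuous S₂ d
    ... | k , d′ = k , inj₂ (e , d′)
    continuous (while_loop b S) d = continuous-while b S d
    continuous (call p) (inj₁ d)           = 0 , inj₁ d
    continuous (call p) (inj₂ (i , k , d)) = k , inj₂ (i , d)

    continuous-while b S (stop ¬b) = 0 , stop ¬b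
    continuous-while b S (step b✓ d w) with continuous S d | continuous-while b S w
    ... | j , d′ | k , w′ =
      j ℕ.⊔ k , step b✓ (lift S (m≤m⊔n j k) d′)
                        (While-mono (lift S (m≤n⊔m j k)) w′)

    union-isLeastFixedPoint : IsLeastFixedPoint _⊑_ (ξ I D ρ⁻) union
    union-isLeastFixedPoint = record
      { prefixed  = (λ i → i) , pre
      ; postfixed = (λ i → i) , post
      ; least     = λ {σ} le → (λ i → i) , λ { p i (k , d) → below {σ} le k p i d }
      }
      where
      pre : ∀ p (i : p ∈ P⁺ I) → ξ I D ρ⁻ union p i ⇒ union p i
      pre p i d with continuous (D p i) d
      ... | k , d′ = suc k , d′

      post : ∀ p (i : p ∈ P⁺ I) → union p i ⇒ ξ I D ρ⁻ union p i
      post p i (suc k , d) = ⟦⟧-mono I (D p i) ((λ j → j) , λ _ _ e → k , e) d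

      below : ∀ {σ : Env (P⁺ I)} → ξ I D ρ⁻ σ ⊑ σ →
              ∀ k p (i : p ∈ P⁺ I) → chain k p i ⇒ σ p i
      below le zero    p i ()
      below le (suc k) p i d =
        proj₂ le p i (⟦⟧-mono I (D p i) ((λ j → j) , below le k) d)

  ξ-lfp : ∀ I (D : Decls (P⁺ I)) (ρ⁻ : Env (P⁻ I)) → LeastFixedPoint _⊑_ (ξ I D ρ⁻)
  ξ-lfp I D ρ⁻ = record
    { point             = Kleene.union I D ρ⁻
    ; isLeastFixedPoint = Kleene.union-isLeastFixedPoint I D ρ⁻
    }

  ρ₀⁺ : ∀ I → Decls (P⁺ I) → Env (P⁻ I) → Env (P⁺ I)
  ρ₀⁺ I D ρ⁻ = LeastFixedPoint.point (ξ-lfp I D ρ⁻)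

  standard : ∀ I → Decls (P⁺ I) → Stmt → Env (P⁻ I) → Rel State 0ℓ
  standard I D S ρ⁻ = (I ⟦ S ⟧) ρ⁻ (ρ₀⁺ I D ρ⁻)


  record HoareContract : Set where
    constructor ⟨_,_⟩
    field
      pre post : Assertion

  ⟦_⟧ᶜ : HoareContract → Rel State 0ℓ
  ⟦ ⟨ P , Q ⟩ ⟧ᶜ s s′ = ∀ ℐ → s ⊨[ ℐ ] P → s′ ⊨[ ℐ ] Q

  ρc : (Fin n → HoareContract) → Env ⊤
  ρc C p _ = ⟦ C p ⟧ᶜ

  allRequired : Interface
  allRequired = record
    { P⁻       = ⊤
    ; P⁺       = ⊥
    ; disjoint = λ (_ , i) → ∉⊥ (p∩q⊆q ⊤ ⊥ i)
    }

  noDecls : Decls ⊥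
  noDecls p p∈⊥ = ⊥-elim-irr (∉⊥ p∈⊥)

  ⟦_⟧ᶜʳ : Stmt → (Fin n → HoareContract) → Rel State 0ℓ
  ⟦ S ⟧ᶜʳ C = standard allRequired noDecls S (ρc C)

  infix 4 _⊢_⊨ᶜʳ_
  _⊢_⊨ᶜʳ_ : (Fin n → HoareContract) → Stmt → HoareContract → Set
  C ⊢ S ⊨ᶜʳ H = ⟦ S ⟧ᶜʳ C ⇒ ⟦ H ⟧ᶜ


  record Component : Set₁ where
    field
      interface : Interface
      apply     : Env (P⁻ interface) → Env (P⁺ interface)

  record DenotationalContract : Set₁ where
    field
      interface : Interface
      ρ⁻        : Env (P⁻ interface)
      ρ⁺        : Env (P⁺ interface)

  ⊆-∪-─ : ∀ (P Q : Subset n) → P ⊆ Q ∪ (P ─ Q)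
  ⊆-∪-─ P Q {x} x∈P with x ∈? Q
  ... | yes x∈Q = p⊆p∪q (P ─ Q) x∈Q
  ... | no  x∉Q = q⊆p∪q Q (P ─ Q) (x∈p∧x∉q⇒x∈p─q x∈P x∉Q)

  -- When P⁻ c ⊆ P⁻ m, the sets P⁻ m and P⁻ c ∪ (P⁻ m ─ P⁻ c) have the same
  -- elements but are not definitionally equal, hence the restriction.
  infix 4 _⊨_
  _⊨_ : Component → DenotationalContract → Set
  m ⊨ c =
    P⁻ c.interface ⊆ P⁻ m.interface ×
    P⁺ m.interface ⊆ P⁺ c.interface ×
    m.apply (restrict (⊆-∪-─ (P⁻ m.interface) (P⁻ c.interface))
                      (c.ρ⁻ ⊔ ρ⊤ (P⁻ m.interface ─ P⁻ c.interface)))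
      ⊑ c.ρ⁺
    where
    module m = Component m
    module c = DenotationalContract c


  ─-disjoint : ∀ {k} (P Q : Subset k) → Empty ((P ─ Q) ∩ Q)
  ─-disjoint (_     ∷ P) (true  ∷ Q) (_ , there i)   = ─-disjoint P Q (_ , i)
  ─-disjoint (_     ∷ P) (false ∷ Q) (_ , there i)   = ─-disjoint P Q (_ , i)
  ─-disjoint (true  ∷ P) (false ∷ Q) (zero , ())
  ─-disjoint (false ∷ P) (false ∷ Q) (zero , ())

  abstraction : ∀ {P} → Decls P → Component
  abstraction {P} D = record
    { interface = I
    ; apply     = λ ρ⁻ p p∈P → standard I D (D p p∈P) ρ⁻
    }
    where
    I : Interface
    I = record
      { P⁻       = called D ─ P
      ; P⁺       = P
      ; disjoint = ─-disjoint (called D) P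
      }

  proc_is_ : ∀ p → Stmt → Decls ⁅ p ⁆
  (proc p is S) _ _ = S

  -- The required procedures are the procedures other than p that the body S
  -- of p calls; p itself is provided, hence not required.
  contractOf : (Fin n → HoareContract) → Fin n → Stmt → DenotationalContract
  contractOf C p S = record
    { interface = record
      { P⁻       = calls S ─ ⁅ p ⁆
      ; P⁺       = ⁅ p ⁆
      ; disjoint = ─-disjoint (calls S) ⁅ p ⁆
      }
    ; ρ⁻ = λ p′ _ → ρc C p′ ∈⊤
    ; ρ⁺ = λ p′ _ → ρc C p′ ∈⊤
    }

{-# OPTIONS --safe #-}

-- Denotations depend only on the relations assigned to the called procedures.
-- Interpreting p by its contract makes the contract-relative denotation of Sₚ
-- the image of ρc under ξ, so C ⊢ Sₚ ⊨ᶜʳ C p says that ρc is a pre-fixed point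
-- of ξ and hence lies above the least fixed point. If p is not recursive, the
-- provided environment is irrelevant, and the two denotations coincide.
module Submission where

open import Defs
open import Data.Empty using (⊥-elim)
open import Data.Fin.Base using (Fin)
open import Data.Fin.Subset using (Subset; _∈_; _∉_; _⊆_; _─_; ⋃; ⁅_⁆)
open import Data.Fin.Subset.Properties
  using (_∈?_; ∉⊥; ∈⊤; p⊆p∪q; q⊆p∪q; x∈p∩q⁺; x∈⁅x⁆; x∈⁅y⁆⇒x≡y;
         p─q⊆p; x∈p∧x∉q⇒x∈p─q)
open import Data.List.Base using (List; map; allFin; []; _∷_)
import Data.List.Membership.Propositional as List
open import Data.List.Membership.Propositional.Properties using (∈-map⁺; ∈-allFin)
open import Data.List.Relation.Unary.Any using (here; there)
open import Data.Nat.Base using (ℕ)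
open import Data.Product.Base using (_×_; _,_; proj₂)
open import Data.Sum.Base using (inj₁; inj₂)
open import Relation.Binary.Core using (_⇒_)
open import Relation.Binary.PropositionalEquality using (refl; sym; subst)
open import Relation.Nullary.Decidable using (yes; no)

∈⇒⊆⋃ : ∀ {n} {P : Subset n} {Ps : List (Subset n)} → P List.∈ Ps → P ⊆ ⋃ Ps
∈⇒⊆⋃ {Ps = P ∷ Ps} (here refl)  i = p⊆p∪q (⋃ Ps) i
∈⇒⊆⋃ {Ps = P ∷ Ps} (there P∈Ps) i = q⊆p∪q P (⋃ Ps) (∈⇒⊆⋃ P∈Ps i)

module _ (L : Language) (n : ℕ) where
  open Theory L n
  open Interface

  x∈P─Q⇒x∉Q : ∀ {P Q : Subset n} {x} → x ∈ P ─ Q → x ∉ Q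
  x∈P─Q⇒x∉Q {P} {Q} x∈P─Q x∈Q = ─-disjoint P Q (_ , x∈p∩q⁺ (x∈P─Q , x∈Q))

  -- Every construct is monotone in the relations of its calls, so induction on `S` suffices.
  -- Comparing denotations of `call q`, not environments, lets `I` and `J` split the procedures
  -- differently into required and provided.
  ⟦⟧-local : ∀ I J {ρ⁻ ρ⁺ σ⁻ σ⁺} S →
             (∀ q → q ∈ calls S →
              (I ⟦ call q ⟧) ρ⁻ ρ⁺ ⇒ (J ⟦ call q ⟧) σ⁻ σ⁺) →
             (I ⟦ S ⟧) ρ⁻ ρ⁺ ⇒ (J ⟦ S ⟧) σ⁻ σ⁺
  ⟦⟧-local I J skip f d = d
  ⟦⟧-local I J (x ≔ a) f d = d
  ⟦⟧-local I J (S₁ ⨾ S₂) f (t , d , e) =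
    t , ⟦⟧-local I J S₁ (λ q i → f q (p⊆p∪q (calls S₂) i)) d
      , ⟦⟧-local I J S₂ (λ q i → f q (q⊆p∪q (calls S₁) _ i)) e
  ⟦⟧-local I J (if_then_else′ b S₁ S₂) f (inj₁ (e , d)) =
    inj₁ (e , ⟦⟧-local I J S₁ (λ q i → f q (p⊆p∪q (calls S₂) i)) d)
  ⟦⟧-local I J (if_then_else′ b S₁ S₂) f (inj₂ (e , d)) =
    inj₂ (e , ⟦⟧-local I J S₂ (λ q i → f q (q⊆p∪q (calls S₁) _ i)) d)
  ⟦⟧-local I J (while_loop b S) f d = While-mono (⟦⟧-local I J S f) d
  ⟦⟧-local I J (call p) f d = f p (x∈⁅x⁆ p) d

  calls⊆calledBy : ∀ p S → calls S ⊆ calledBy (proc p is S) p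
  calls⊆calledBy p S i with p ∈? ⁅ p ⁆
  ... | yes _   = i
  ... | no  p∉p = ⊥-elim (p∉p (x∈⁅x⁆ p))

  calls⊆called : ∀ p S → calls S ⊆ called (proc p is S)
  calls⊆called p S i =
    ∈⇒⊆⋃ (∈-map⁺ (calledBy (proc p is S)) (∈-allFin p)) (calls⊆calledBy p S i)

  module _ (C : Fin n → HoareContract) (p : Fin n) (S : Stmt) where

    module m = Component (abstraction (proc p is S))
    module c = DenotationalContract (contractOf C p S)

    ρ⁻ : Env (P⁻ m.interface)
    ρ⁻ = restrict (⊆-∪-─ (P⁻ m.interface) (P⁻ c.interface))
                  (c.ρ⁻ ⊔ ρ⊤ (P⁻ m.interface ─ P⁻ c.interface))

    required⊆ : P⁻ c.interface ⊆ P⁻ m.interface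
    required⊆ i = x∈p∧x∉q⇒x∈p─q
      (calls⊆called p S (p─q⊆p (calls S) ⁅ p ⁆ i)) (x∈P─Q⇒x∉Q i)

    ξ⇒cr : (m.interface ⟦ S ⟧) ρ⁻ c.ρ⁺ ⇒ ⟦ S ⟧ᶜʳ C
    ξ⇒cr = ⟦⟧-local m.interface allRequired S λ where
      q q∈S (inj₁ (_ , inj₁ (_ , d))) → inj₁ (∈⊤ , d)
      -- A called `q` required by `m` differs from `p`, so `c` requires it too, contradicting
      -- `q∈m─c`.
      q q∈S (inj₁ (q∈m , inj₂ (q∈m─c , _))) →
        ⊥-elim (x∈P─Q⇒x∉Q q∈m─c (x∈p∧x∉q⇒x∈p─q q∈S (x∈P─Q⇒x∉Q q∈m)))
      q q∈S (inj₂ (_ , d)) → inj₁ (∈⊤ , d)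

    cr⇒⟦⟧ : p ∉ calls S → ∀ ρ⁺ → ⟦ S ⟧ᶜʳ C ⇒ (m.interface ⟦ S ⟧) ρ⁻ ρ⁺
    cr⇒⟦⟧ p∉S ρ⁺ = ⟦⟧-local allRequired m.interface S λ where
      -- Since `q` is not `p`, `c` requires it, and `ρ⁻` admits the contract relation through its
      -- left summand.
      q q∈S (inj₁ (_ , d)) →
        let q∉p = λ q∈p → p∉S (subst (_∈ calls S) (x∈⁅y⁆⇒x≡y p q∈p) q∈S)
            q∈c = x∈p∧x∉q⇒x∈p─q q∈S q∉p
        in inj₁ (required⊆ q∈c , inj₁ (q∈c , d))
      q q∈S (inj₂ (q∈⊥ , _)) → ⊥-elim (∉⊥ q∈⊥)

    cr⇒⊨ : C ⊢ S ⊨ᶜʳ C p → abstraction (proc p is S) ⊨ contractOf C p S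
    cr⇒⊨ S⊨C = required⊆ , (λ i → i) , (λ i → i) , λ q q∈p d →
      -- `apply` yields the body's denotation at the least fixed point; `prefixed` takes `d` into
      -- the fixed point itself, and `least` takes it on into the contract.
      proj₂ (least ρc-prefixed) q q∈p (proj₂ prefixed q q∈p d)
      where
      open IsLeastFixedPoint
        (LeastFixedPoint.isLeastFixedPoint (ξ-lfp m.interface (proc p is S) ρ⁻))

      ρc-prefixed : ξ m.interface (proc p is S) ρ⁻ c.ρ⁺ ⊑ c.ρ⁺
      ρc-prefixed = (λ i → i) , λ q q∈p {s} {s′} d →
        subst (λ r → ⟦ C r ⟧ᶜ s s′) (sym (x∈⁅y⁆⇒x≡y p q∈p)) (S⊨C (ξ⇒cr d))

    -- Recursion would break this: for the body `call p ⨾ (x ≔ a)` the least fixed point is empty,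
    -- so the component implements any contract of `p`, while that contract need not be closed under
    -- the assignment.
    ⊨⇒cr : p ∉ calls S →
           abstraction (proc p is S) ⊨ contractOf C p S → C ⊢ S ⊨ᶜʳ C p
    ⊨⇒cr p∉S (_ , _ , _ , m⊑c) d = m⊑c p (x∈⁅x⁆ p) (cr⇒⟦⟧ p∉S _ d)

theorem5 : (L : Language) (n : ℕ) → let open Theory L n in
    (C : Fin n → HoareContract) (p : Fin n) (Sₚ : Stmt) →
    (C ⊢ Sₚ ⊨ᶜʳ C p → abstraction (proc p is Sₚ) ⊨ contractOf C p Sₚ) ×
    (p ∉ calls Sₚ →
    abstraction (proc p is Sₚ) ⊨ contractOf C p Sₚ → C ⊢ Sₚ ⊨ᶜʳ C p)
theorem5 L n C p Sₚ = cr⇒⊨ L n C p Sₚ , ⊨⇒cr L n C p Sₚ
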